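{- Let $n\ge 3$, $1\le t<n$, and let $c_1,c_2,\ldots,c_t\in[n]$ be distinct integers such that the sequence $(c_1,\ldots,c_t)$ avoids the pattern $231$. If $c_i<c_j$ for some $1\le i<j\le t$ and there exists $\alpha\in[n]$ with $\alpha<c_i$ and $\alpha\notin\{c_1,\ldots,c_t\}$ (for that same $i$), then $|S_{n,(c_1,\ldots,c_t)}(231)|=0$; otherwise, $$|S_{n,(c_1,\ldots,c_t)}(231)|=\prod_{k=1}^{t+1}C_{c_{(k)}-c_{(k-1)}-1},$$ where $C_i=\frac{1}{i+1}\binom{2i}{i}$ is the $i$th Catalan number, $c_{(0)}=0$, $c_{(t+1)}=n+1$, and $c_{(1)}<c_{(2)}<\cdots<c_{(t)}$ are the elements of $\{c_1,\ldots,c_t\}$ listed in increasing order.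
   Context: $[n]=\{1,\ldots,n\}$ and $S_n$ is the set of permutations of $[n]$ written as sequences $(\tau(1),\ldots,\tau(n))$. A sequence of distinct integers $\tau=(\tau(1),\ldots,\tau(m))$ contains $\sigma\in S_k$ as a pattern if there are indices $1\le i_1<\cdots<i_k\le m$ such that for all $1\le a<b\le k$, $\tau(i_a)<\tau(i_b)$ if and only if $\sigma(a)<\sigma(b)$; otherwise $\tau$ avoids $\sigma$. $S_{n,(c_1,\ldots,c_t)}(\sigma_1,\ldots,\sigma_m)$ is the set of $\tau\in S_n$ with $(\tau(1),\ldots,\tau(t))=(c_1,\ldots,c_t)$ that avoid all of $\sigma_1,\ldots,\sigma_m$. -}

module Defs where

open import Data.Fin.Base using (Fin; toℕ; inject≤; _<_)
open import Data.Fin.Patterns using (0F; 1F; 2F)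
open import Data.Fin.Permutation as Perm using (Permutation′; permutation; _⟨$⟩ʳ_)
open import Data.List.Base using (List; _∷_; [_]; _++_; tabulate; zipWith)
open import Data.List.Relation.Unary.All using (All)
import Data.List.Sort as Sort
open import Data.Nat.Base as ℕ using (ℕ; suc; _*_; _∸_; _/_)
open import Data.Nat.Combinatorics using (_C_)
open import Data.Nat.ListAction using (product)
open import Data.Nat.Properties using (≤-decTotalOrder)
open import Data.Product.Base using (Σ-syntax; ∃; _×_; _,_; proj₁)
open import Function.Base using (_∘_)
open import Function.Bundles using (Inverse; _⇔_)
open import Level using (0ℓ)
open import Relation.Binary.Bundles using (Setoid)
import Relation.Binary.Construct.On as On
open import Relation.Binary.PropositionalEquality.Core using (_≡_; refl; sym; trans)
open import Relation.Binary.PropositionalEquality.Properties using (setoid)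
open import Relation.Nullary.Negation.Core using (¬_)

open Sort ≤-decTotalOrder using (sort)

private
  variable
    k m n t : ℕ

-- Fin n stands for [n] = {1,…,n}, with x : Fin n denoting the integer
-- label x; positions are shifted by one in the same way.  Only order
-- comparisons matter for patterns, so they are made directly on Fin n.

label : Fin n → ℕ
label x = suc (toℕ x)

Contains : (Fin m → Fin n) → Permutation′ k → Set
Contains {m} {n} {k} τ σ =
  Σ[ ι ∈ (Fin k → Fin m) ]
    (∀ {a b} → a < b → ι a < ι b) ×
    (∀ {a b} → a < b → (τ (ι a) < τ (ι b)) ⇔ (σ ⟨$⟩ʳ a < σ ⟨$⟩ʳ b))

Avoids : (Fin m → Fin n) → Permutation′ k → Set
Avoids τ σ = ¬ Contains τ σ

pattern231 : Permutation′ 3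
pattern231 = permutation to from
  (λ { 0F → refl ; 1F → refl ; 2F → refl })
  (λ { 0F → refl ; 1F → refl ; 2F → refl })
  where
  to from : Fin 3 → Fin 3
  to 0F = 1F
  to 1F = 2F
  to 2F = 0F
  from 0F = 2F
  from 1F = 0F
  from 2F = 1F

-- Permutations are functions packaged with proofs, so they are compared
-- pointwise, i.e. as the sequences (τ(1),…,τ(n)).

permSetoid : ℕ → Setoid 0ℓ 0ℓ
permSetoid n = record
  { Carrier       = Permutation′ n
  ; _≈_           = Perm._≈_
  ; isEquivalence = record
    { refl  = λ _ → refl
    ; sym   = λ p i → sym (p i)
    ; trans = λ p q i → trans (p i) (q i)
    }
  }

HasPrefix : .(t ℕ.≤ n) → (Fin t → Fin n) → Permutation′ n → Set
HasPrefix t≤n c τ = ∀ i → τ ⟨$⟩ʳ inject≤ i t≤n ≡ c i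

-- S_{n,(c₁,…,c_t)}(σ₁,…,σ_m), with patterns of arbitrary lengths.
-- Membership proofs are ignored by the equality.

S : .(t ℕ.≤ n) → (Fin t → Fin n) → List (∃ Permutation′) → Setoid 0ℓ 0ℓ
S {t} {n} t≤n c σs = On.setoid (permSetoid n) (proj₁ {B = Member})
  where
  Member : Permutation′ n → Set
  Member τ = HasPrefix t≤n c τ × All (λ (_ , σ) → Avoids (τ ⟨$⟩ʳ_) σ) σs

HasCardinality : Setoid 0ℓ 0ℓ → ℕ → Set
HasCardinality A k = Inverse A (setoid (Fin k))

-- The division is exact.

catalan : ℕ → ℕ
catalan i = ((2 * i) C i) / suc i

-- For s = (c₍₁₎,…,c₍ₜ₎), the two zipped lists are (c₍₀₎,…,c₍ₜ₎) and
-- (c₍₁₎,…,c₍ₜ₊₁₎), where c₍₀₎ = 0 and c₍ₜ₊₁₎ = n + 1.  For distinct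
-- entries the truncated subtractions are genuine.

catalanProduct : (Fin t → Fin n) → ℕ
catalanProduct {n = n} c =
  product (zipWith (λ x y → catalan (y ∸ x ∸ 1)) (0 ∷ s) (s ++ [ suc n ]))
  where
  s : List ℕ
  s = sort (tabulate (label ∘ c))

{-# OPTIONS --safe #-}
module Submission where

-- Write a permutation with prefix c as c ++ w.  It avoids 231 exactly when c
-- and w do, no ascent of c lies above an entry of w, and, for each entry v of
-- c, the entries of w below v precede those above v.  Unless the prefix is
-- blocked, w is therefore a concatenation, in increasing order, of 231-avoiding
-- arrangements of the gaps between consecutive entries of sorted c.  A nonempty
-- arrangement is its first entry v followed by such a w for c = (v), which
-- yields the Catalan recurrence; the convolution identity it needs follows from
-- the Pascal-like recurrence of the ballot numbers, as does the closed form.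

open import Defs
open import Data.Empty using (⊥; ⊥-elim)
open import Data.Fin.Base using (Fin; zero; suc; toℕ; fromℕ<; inject≤; _<_)
open import Data.Fin.Patterns using (0F; 1F; 2F)
open import Data.Fin.Permutation using (Permutation′; permutation; _⟨$⟩ʳ_; _⟨$⟩ˡ_; inverseʳ)
import Data.Fin.Properties as Fin
open import Data.List.Base
  using (List; []; _∷_; [_]; _++_; cartesianProductWith; drop; length; lookup; map; tabulate; zipWith)
open import Data.List.Membership.Propositional using (_∈_; _∉_)
open import Data.List.Membership.Propositional.Properties
  using (∈-++⁺ˡ; ∈-++⁺ʳ; ∈-++⁻; ∈-map⁺; ∈-map⁻; ∈-cartesianProductWith⁺; ∈-cartesianProductWith⁻;
         ∈-tabulate⁺; ∈-tabulate⁻; ∈-lookup)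
open import Data.List.Membership.Propositional.Properties.WithK using (unique∧set⇒bag)
open import Data.List.Properties
  using (++-cancelˡ; length-++; length-map; length-tabulate; tabulate-cong;
         ∷-injective; ∷-injectiveˡ; ∷-injectiveʳ)
open import Data.List.Relation.Binary.BagAndSetEquality using (∼bag⇒↭)
open import Data.List.Relation.Binary.Permutation.Propositional using (_↭_; ↭-sym; ↭⇒↭ₛ)
open import Data.List.Relation.Binary.Permutation.Propositional.Properties
  using (All-resp-↭; ∈-resp-↭; ↭-length)
import Data.List.Relation.Binary.Permutation.Setoid.Properties as PermutationSetoid
open import Data.List.Relation.Unary.All as All using (All; []; _∷_)
import Data.List.Relation.Unary.All.Properties as All
open import Data.List.Relation.Unary.AllPairs as AllPairs using (AllPairs; []; _∷_)
import Data.List.Relation.Unary.AllPairs.Properties as AllPairs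
open import Data.List.Relation.Unary.Any as Any using (here; there)
open import Data.List.Relation.Unary.Any.Properties using (lookup-index)
open import Data.List.Relation.Unary.Sorted.TotalOrder.Properties using (Sorted⇒AllPairs)
open import Data.List.Relation.Unary.Unique.Propositional using (Unique)
import Data.List.Relation.Unary.Unique.Propositional.Properties as Unique
import Data.List.Sort as Sort
open import Data.Nat.Base as ℕ using (ℕ; zero; suc; _+_; _*_; _∸_; _/_; s≤s; s<s; z<s)
open import Data.Nat.Combinatorics using (_C_; nCk+nC[k+1]≡[n+1]C[k+1]; nCk≡nC[n∸k]; nC1≡n)
open import Data.Nat.DivMod using (m*n/n≡m)
open import Data.Nat.ListAction using (product)
import Data.Nat.Properties as ℕ
open import Data.Nat.Properties using (<⇒≤)
open import Data.Nat.Tactic.RingSolver using (solve-∀)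
open import Data.Product.Base using (Σ-syntax; ∃₂; ∃-syntax; _×_; _,_; proj₁; proj₂)
open import Data.Sum.Base as Sum using (_⊎_; inj₁; inj₂; [_,_]′)
open import Function.Base using (_∘_)
open import Function.Bundles using (_⇔_; mk⇔; Equivalence; Inverse)
open import Function.Definitions using (Injective)
open import Level using (0ℓ)
open import Relation.Binary.Bundles using (Setoid)
open import Relation.Binary.Definitions using (tri<; tri≈; tri>)
open import Relation.Binary.PropositionalEquality
  using (_≡_; _≢_; refl; sym; trans; cong; cong₂; subst; subst₂; setoid; module ≡-Reasoning)
open import Relation.Nullary.Decidable.Core using (yes; no)
open import Relation.Nullary.Negation using (¬_; contradiction)

open import Data.List.Membership.DecPropositional ℕ._≟_ using (_∈?_)
open Sort ℕ.≤-decTotalOrder using (sort; sort-↭; sort-↗)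

-- Ballot numbers, binomial coefficients and the Catalan closed form.

-- The number of ordered forests of k binary trees with m internal nodes in
-- total: inspect the first tree, which is a leaf or a root with two subtrees.
ballot : ℕ → ℕ → ℕ
ballot zero    zero    = 1
ballot zero    (suc m) = 0
ballot (suc k) zero    = 1
ballot (suc k) (suc m) = ballot k (suc m) + ballot (2 + k) m

-- The difference formula of the reflection principle, in additive form because subtraction on `ℕ`
-- truncates. Both recursive cases, `(k , suc m)` and `(2 + k , m)`, live in the row `M` just before
-- that of `(suc k , suc m)`, so Pascal's rule carries the induction; `k = 0` is the symmetry of an
-- odd row.
ballot-nC : ∀ k m → ballot k (suc m) + (k + suc (m + m)) C m ≡ (k + suc (m + m)) C suc m
ballot-nC zero m = begin
  suc (m + m) C m                      ≡⟨ nCk≡nC[n∸k] (ℕ.m≤n⇒m≤1+n (ℕ.m≤m+n m m)) ⟩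
  suc (m + m) C (suc (m + m) ℕ.∸ m)    ≡⟨ cong (suc (m + m) C_) (ℕ.m+n∸n≡m (suc m) m) ⟩
  suc (m + m) C suc m                  ∎
  where open ≡-Reasoning
ballot-nC (suc k) zero = begin
  ballot k 1 + 1 + 1                   ≡⟨ ℕ.+-comm (ballot k 1 + 1) 1 ⟩
  1 + (ballot k 1 + 1)                 ≡⟨ cong suc (ballot-nC k 0) ⟩
  1 + (k + 1) C 1                      ≡⟨ nCk+nC[k+1]≡[n+1]C[k+1] (k + 1) 0 ⟩
  suc (k + 1) C 1                      ∎
  where open ≡-Reasoning
ballot-nC (suc k) (suc m) = begin
  a + b + suc M C suc m                ≡⟨ cong (a + b +_) (nCk+nC[k+1]≡[n+1]C[k+1] M m) ⟨
  a + b + (M C m + M C suc m)          ≡⟨ rearrange a b (M C m) (M C suc m) ⟩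
  (b + M C m) + (a + M C suc m)        ≡⟨ cong₂ _+_ b-nC (ballot-nC k (suc m)) ⟩
  M C suc m + M C suc (suc m)          ≡⟨ nCk+nC[k+1]≡[n+1]C[k+1] M (suc m) ⟩
  suc M C suc (suc m)                  ∎
  where
  open ≡-Reasoning
  a b M : ℕ
  a = ballot k (2 + m)
  b = ballot (2 + k) (suc m)
  M = k + suc (suc m + suc m)
  rearrange : ∀ a b c d → a + b + (c + d) ≡ (b + c) + (a + d)
  rearrange = solve-∀
  M≡ : ∀ k m → 2 + k + suc (m + m) ≡ k + suc (suc m + suc m)
  M≡ = solve-∀
  b-nC : b + M C m ≡ M C suc m
  b-nC = subst (λ N → b + N C m ≡ N C suc m) (M≡ k m) (ballot-nC (2 + k) m)

nC-absorption : ∀ n k → suc k * (suc n C suc k) ≡ suc n * (n C k)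
nC-absorption n zero = begin
  1 * (suc n C 1)     ≡⟨ cong (1 *_) (nC1≡n (suc n)) ⟩
  1 * suc n           ≡⟨ ℕ.*-comm 1 (suc n) ⟩
  suc n * 1           ∎
  where open ≡-Reasoning
nC-absorption zero (suc k) = ℕ.*-zeroʳ (suc (suc k))
nC-absorption (suc n) (suc k) = begin
  (2 + k) * ((2 + n) C (2 + k))
    ≡⟨ cong ((2 + k) *_) (nCk+nC[k+1]≡[n+1]C[k+1] (suc n) (suc k)) ⟨
  (2 + k) * (c + suc n C (2 + k))
    ≡⟨ expand k c (suc n C (2 + k)) ⟩
  c + (suc k * c + (2 + k) * (suc n C (2 + k)))
    ≡⟨ cong (c +_) (cong₂ _+_ (nC-absorption n k) (nC-absorption n (suc k))) ⟩
  c + (suc n * (n C k) + suc n * (n C suc k))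
    ≡⟨ cong (c +_) (ℕ.*-distribˡ-+ (suc n) (n C k) (n C suc k)) ⟨
  c + suc n * (n C k + n C suc k)
    ≡⟨ cong (λ x → c + suc n * x) (nCk+nC[k+1]≡[n+1]C[k+1] n k) ⟩
  (2 + n) * c ∎
  where
  open ≡-Reasoning
  c : ℕ
  c = suc n C suc k
  expand : ∀ k c d → (2 + k) * (c + d) ≡ c + (suc k * c + (2 + k) * d)
  expand = solve-∀

-- The division is exact because `(m + 2) * ballot 1 (m + 1)` is the central binomial coefficient:
-- multiply `ballot-nC` at `k = 1` by `m + 2`, rewrite the lower coefficient by absorption, and
-- cancel.
catalan≡ballot : ∀ m → catalan m ≡ ballot 1 m
catalan≡ballot zero    = refl
catalan≡ballot (suc m) = begin
  ((2 * suc m) C suc m) / suc (suc m)  ≡⟨ cong (λ N → (N C suc m) / suc (suc m)) (2*≡ m) ⟩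
  (N C suc m) / suc (suc m)            ≡⟨ cong (_/ suc (suc m)) b*[m+2] ⟨
  (b * suc (suc m)) / suc (suc m)      ≡⟨ m*n/n≡m b (suc (suc m)) ⟩
  b                                    ∎
  where
  open ≡-Reasoning
  b N : ℕ
  b = ballot 1 (suc m)
  N = 2 + (m + m)
  2*≡ : ∀ m → 2 * suc m ≡ 2 + (m + m)
  2*≡ = solve-∀
  nC-shift : suc (suc m) * (N C m) ≡ suc m * (N C suc m)
  nC-shift = begin
    suc (suc m) * (N C m)
      ≡⟨ cong (suc (suc m) *_) (nCk≡nC[n∸k] (ℕ.m≤n⇒m≤1+n (ℕ.m≤n⇒m≤1+n (ℕ.m≤m+n m m)))) ⟩
    suc (suc m) * (N C (N ∸ m))
      ≡⟨ cong (λ x → suc (suc m) * (N C x)) (ℕ.m+n∸n≡m (2 + m) m) ⟩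
    suc (suc m) * (N C suc (suc m))
      ≡⟨ nC-absorption (suc (m + m)) (suc m) ⟩
    N * (suc (m + m) C suc m)
      -- `ballot 0 (suc m)` is zero, so this instance says that the two central entries of an odd
      -- row agree.
      ≡⟨ cong (N *_) (ballot-nC 0 m) ⟨
    N * (suc (m + m) C m)
      ≡⟨ nC-absorption (suc (m + m)) m ⟨
    suc m * (N C suc m) ∎
  b*[m+2] : b * suc (suc m) ≡ N C suc m
  b*[m+2] = ℕ.+-cancelʳ-≡ (suc m * (N C suc m)) _ _ (begin
    b * suc (suc m) + suc m * (N C suc m)       ≡⟨ cong₂ _+_ (ℕ.*-comm b (2 + m)) (sym nC-shift) ⟩
    (2 + m) * b + (2 + m) * (N C m)             ≡⟨ ℕ.*-distribˡ-+ (2 + m) b (N C m) ⟨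
    (2 + m) * (b + N C m)                       ≡⟨ cong ((2 + m) *_) (ballot-nC 1 m) ⟩
    N C suc m + suc m * (N C suc m)             ∎)

-- Convolution of ballot numbers.

-- Σ f (i + l) * g (j ∸ l), over 0 ≤ l ≤ j.
convolve : (ℕ → ℕ) → (ℕ → ℕ) → ℕ → ℕ → ℕ
convolve f g i zero    = f i * g 0
convolve f g i (suc j) = f i * g (suc j) + convolve f g (suc i) j

convolve-+ : ∀ f f′ g i j →
  convolve (λ x → f x + f′ x) g i j ≡ convolve f g i j + convolve f′ g i j
convolve-+ f f′ g i zero    = ℕ.*-distribʳ-+ (g 0) (f i) (f′ i)
convolve-+ f f′ g i (suc j) = begin
  (f i + f′ i) * g (suc j) + convolve (λ x → f x + f′ x) g (suc i) j
    ≡⟨ cong₂ _+_ (ℕ.*-distribʳ-+ (g (suc j)) (f i) (f′ i)) (convolve-+ f f′ g (suc i) j) ⟩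
  (f i * g (suc j) + f′ i * g (suc j)) + (convolve f g (suc i) j + convolve f′ g (suc i) j)
    ≡⟨ interchange (f i * g (suc j)) _ _ _ ⟩
  _ ∎
  where
  open ≡-Reasoning
  interchange : ∀ a b c d → (a + b) + (c + d) ≡ (a + c) + (b + d)
  interchange = solve-∀

convolve-suc : ∀ f g i j → convolve f g (suc i) j ≡ convolve (λ x → f (suc x)) g i j
convolve-suc f g i zero    = refl
convolve-suc f g i (suc j) = cong (f (suc i) * g (suc j) +_) (convolve-suc f g (suc i) j)

convolve-zeroˡ : ∀ g i j → convolve (λ _ → 0) g i j ≡ 0
convolve-zeroˡ g i zero    = refl
convolve-zeroˡ g i (suc j) = convolve-zeroˡ g (suc i) j

-- Cutting a forest of `j + k` trees after its first `j` distributes the nodes over two forests. The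
-- index `j` is general because the recurrence raises it to `2 + j`, even when the aim is
-- `j = k = 1`.
ballot-convolve : ∀ j k m → convolve (ballot j) (ballot k) 0 m ≡ ballot (j + k) m
ballot-convolve zero    zero    zero = refl
ballot-convolve zero    (suc k) zero = refl
ballot-convolve (suc j) zero    zero = refl
ballot-convolve (suc j) (suc k) zero = refl
ballot-convolve zero k (suc m) = begin
  1 * ballot k (suc m) + convolve (ballot 0) (ballot k) 1 m
    ≡⟨ cong₂ _+_ (ℕ.*-identityˡ (ballot k (suc m)))
                 (trans (convolve-suc (ballot 0) (ballot k) 0 m) (convolve-zeroˡ (ballot k) 0 m)) ⟩
  ballot k (suc m) + 0   ≡⟨ ℕ.+-identityʳ _ ⟩
  ballot k (suc m)       ∎
  where open ≡-Reasoning
ballot-convolve (suc j) k (suc m) = begin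
  1 * g (suc m) + convolve (ballot (suc j)) g 1 m
    ≡⟨ cong (1 * g (suc m) +_) (convolve-suc (ballot (suc j)) g 0 m) ⟩
  1 * g (suc m) + convolve (λ x → ballot j (suc x) + ballot (2 + j) x) g 0 m
    ≡⟨ cong (1 * g (suc m) +_) (convolve-+ (λ x → ballot j (suc x)) (ballot (2 + j)) g 0 m) ⟩
  1 * g (suc m) + (convolve (λ x → ballot j (suc x)) g 0 m + convolve (ballot (2 + j)) g 0 m)
    ≡⟨ ℕ.+-assoc (1 * g (suc m)) _ _ ⟨
  1 * g (suc m) + convolve (λ x → ballot j (suc x)) g 0 m + convolve (ballot (2 + j)) g 0 m
    ≡⟨ cong₂ _+_ (trans head (ballot-convolve j k (suc m))) (ballot-convolve (2 + j) k m) ⟩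
  ballot (j + k) (suc m) + ballot (2 + j + k) m ∎
  where
  open ≡-Reasoning
  g : ℕ → ℕ
  g = ballot k
  ballot-zero : ∀ j → ballot j 0 ≡ 1
  ballot-zero zero    = refl
  ballot-zero (suc j) = refl
  -- The leading `1` is also `ballot j 0`, so the stray term completes the shifted sum to a full
  -- convolution for `j`.
  head : 1 * g (suc m) + convolve (λ x → ballot j (suc x)) g 0 m ≡ convolve (ballot j) g 0 (suc m)
  head = sym (cong₂ (λ x y → x * g (suc m) + y) (ballot-zero j) (convolve-suc (ballot j) g 0 m))

-- Pairwise relations and cuts in lists.

module _ {A : Set} where

  All⇒AllPairs : ∀ {P : A → Set} {R : A → A → Set} {xs} →
                 (∀ {x y} → P x → R x y) → All P xs → AllPairs R xs
  All⇒AllPairs f []         = []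
  All⇒AllPairs f (px ∷ pxs) = All.universal (λ _ → f px) _ ∷ All⇒AllPairs f pxs

  AllPairs-++⁻ : ∀ {R : A → A → Set} xs {ys} → AllPairs R (xs ++ ys) →
                 AllPairs R xs × AllPairs R ys × All (λ x → All (R x) ys) xs
  AllPairs-++⁻ []       rs       = [] , rs , []
  AllPairs-++⁻ (x ∷ xs) (r ∷ rs) =
    let rxs , rys , rxys = AllPairs-++⁻ xs rs
    in All.++⁻ˡ xs r ∷ rxs , rys , All.++⁻ʳ xs r ∷ rxys

  -- `P` marks the cut: it holds everywhere to the left and nowhere to the right, so the
  -- concatenation determines where it was joined.
  ++-injective-by : ∀ {P : A → Set} {xs xs′ ys ys′} →
                    All P xs → All P xs′ → All (¬_ ∘ P) ys → All (¬_ ∘ P) ys′ →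
                    xs ++ ys ≡ xs′ ++ ys′ → xs ≡ xs′ × ys ≡ ys′
  ++-injective-by []       []       _        _        eq   = refl , eq
  ++-injective-by []       (p ∷ _)  (¬p ∷ _) _        refl = contradiction p ¬p
  ++-injective-by (p ∷ _)  []       _        (¬p ∷ _) refl = contradiction p ¬p
  ++-injective-by (_ ∷ ps) (_ ∷ qs) rs       rs′      eq
    with refl , eq′ ← ∷-injective eq
    with refl , eq″ ← ++-injective-by ps qs rs rs′ eq′ = refl , eq″

-- Avoidance of 231 by words.

-- The entries below v precede those above v.
Separated : ℕ → List ℕ → Set
Separated v = AllPairs (λ a b → v ℕ.< a → v ℕ.< b)

infixr 5 _∷_
-- For words with distinct entries this is avoidance of 231: each entry in turn plays the 2, and
-- `Separated` forbids a 3 followed by a 1 after it.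
data Avoiding : List ℕ → Set where
  []  : Avoiding []
  _∷_ : ∀ {v w} → Separated v w → Avoiding w → Avoiding (v ∷ w)

-- Rules out patterns with their 2 and 3 in `u` and their 1 in `w`.
NoCross : List ℕ → List ℕ → Set
NoCross u w = AllPairs (λ a b → a ℕ.< b → All (a ℕ.<_) w) u

-- The letters of a 231 divide between `u` and `w` as 3+0, 0+3, 1+2 or 2+1; the four hypotheses
-- exclude these in turn.
Avoiding-++⁺ : ∀ {u w} → Avoiding u → Avoiding w →
               All (λ a → Separated a w) u → NoCross u w → Avoiding (u ++ w)
Avoiding-++⁺ []       avw []       []       = avw
Avoiding-++⁺ (s ∷ av) avw (t ∷ ts) (c ∷ cs) =
  AllPairs.++⁺ s t (All.map (λ h → All.tabulate λ b∈w a<x → All.lookup (h a<x) b∈w) c)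
  ∷ Avoiding-++⁺ av avw ts cs

Avoiding-++⁻ : ∀ u {w} → Avoiding (u ++ w) →
               Avoiding w × All (λ a → Separated a w) u × NoCross u w
Avoiding-++⁻ []      av       = av , [] , []
Avoiding-++⁻ (a ∷ u) (s ∷ av) =
  let avw , ts , cs = Avoiding-++⁻ u av
      _ , t , c     = AllPairs-++⁻ u s
  in avw , t ∷ ts , All.map (λ h a<x → All.map (λ k → k a<x) h) c ∷ cs

Avoiding-++⁻ˡ : ∀ u {w} → Avoiding (u ++ w) → Avoiding u
Avoiding-++⁻ˡ []      _        = []
Avoiding-++⁻ˡ (a ∷ u) (s ∷ av) = proj₁ (AllPairs-++⁻ u s) ∷ Avoiding-++⁻ˡ u av

-- Fillings of an interval.

-- What s ++ w being a 231-avoiding arrangement of the open interval (x, y)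
-- requires of w, apart from NoCross s w.
record Filling (x : ℕ) (s : List ℕ) (y : ℕ) (w : List ℕ) : Set where
  field
    unique    : Unique w
    within    : All (λ z → x ℕ.< z × z ℕ.< y × z ∉ s) w
    full      : ∀ {z} → x ℕ.< z → z ℕ.< y → z ∉ s → z ∈ w
    avoiding  : Avoiding w
    separated : All (λ v → Separated v w) s

open Filling

-- Every condition on `s` concerns its entries one at a time, whereas `NoCross` depends on their
-- order. This is what allows a prefix to be sorted before its fillings are counted.
Filling-resp-↭ : ∀ {x s s′ y w} → s ↭ s′ → Filling x s y w → Filling x s′ y w
Filling-resp-↭ s↭s′ F = record
  { unique    = F .unique
  ; within    = All.map (λ (p , q , r) → p , q , r ∘ ∈-resp-↭ (↭-sym s↭s′)) (F .within)
  ; full      = λ p q r → F .full p q (r ∘ ∈-resp-↭ s↭s′)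
  ; avoiding  = F .avoiding
  ; separated = All-resp-↭ s↭s′ (F .separated)
  }

module _ {x y : ℕ} (s : List ℕ) {w : List ℕ} where

  Filling-++⁺ : Unique s → All (λ z → x ℕ.< z × z ℕ.< y) s → Avoiding s → NoCross s w →
                Filling x s y w → Filling x [] y (s ++ w)
  Filling-++⁺ us ws as cross F = record
    { unique    = Unique.++⁺ us (F .unique)
                    (λ (z∈s , z∈w) → proj₂ (proj₂ (All.lookup (F .within) z∈w)) z∈s)
    ; within    = All.++⁺ (All.map (λ (p , q) → p , q , λ ()) ws)
                          (All.map (λ (p , q , _) → p , q , λ ()) (F .within))
    ; full      = λ p q _ → ∈-full p q
    ; avoiding  = Avoiding-++⁺ as (F .avoiding) (F .separated) cross
    ; separated = []
    }
    where
    ∈-full : ∀ {z} → x ℕ.< z → z ℕ.< y → z ∈ s ++ w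
    ∈-full {z} p q with z ∈? s
    ... | yes z∈s = ∈-++⁺ˡ z∈s
    ... | no  z∉s = ∈-++⁺ʳ s (F .full p q z∉s)

  Filling-++⁻ : Filling x [] y (s ++ w) → Filling x s y w
  Filling-++⁻ F = record
    { unique    = uw
    ; within    = All.tabulate λ {z} z∈w →
        let p , q , _ = All.lookup (All.++⁻ʳ s (F .within)) z∈w
        in p , q , λ z∈s → All.lookup (All.lookup disj z∈s) z∈w refl
    ; full      = λ p q z∉s → [ (λ z∈s → contradiction z∈s z∉s) , (λ z∈w → z∈w) ]′
                                (∈-++⁻ s (F .full p q λ ()))
    ; avoiding  = aw
    ; separated = sep
    }
    where
    us : Unique s × Unique w × All (λ a → All (a ≢_) w) s
    us = AllPairs-++⁻ s (F .unique)
    uw = proj₁ (proj₂ us)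
    disj = proj₂ (proj₂ us)
    as : Avoiding w × All (λ a → Separated a w) s × NoCross s w
    as = Avoiding-++⁻ s (F .avoiding)
    aw = proj₁ as
    sep = proj₁ (proj₂ as)

-- The cut comes just before the first entry above `v`: from there on, separation forces everything
-- above `v`.
Separated-split : ∀ {v} w → v ∉ w → Separated v w →
                  ∃₂ λ l r → w ≡ l ++ r × All (ℕ._< v) l × All (v ℕ.<_) r
Separated-split     []      _   []       = [] , [] , refl , [] , []
Separated-split {v} (z ∷ w) v∉w (h ∷ sw) with ℕ.<-cmp z v
... | tri< z<v _ _ =
  let l , r , eq , l<v , v<r = Separated-split w (v∉w ∘ there) sw
  in z ∷ l , r , cong (z ∷_) eq , z<v ∷ l<v , v<r
... | tri≈ _ z≡v _ = contradiction (here (sym z≡v)) v∉w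
... | tri> _ _ v<z = [] , z ∷ w , refl , [] , v<z ∷ All.map (λ k → k v<z) h

module _ {x v y : ℕ} {s : List ℕ} (x<v : x ℕ.< v) (v<y : v ℕ.< y) (v<s : All (v ℕ.<_) s) where

  -- As `v` is the least entry of `v ∷ s`, no entry of `s` falls between `x` and `v`, and the left
  -- factor fills a plain gap.
  Filling-split : ∀ {w} → Filling x (v ∷ s) y w →
                  ∃₂ λ l r → w ≡ l ++ r × Filling x [] v l × Filling v s y r
  Filling-split {w} F
    with l , r , refl , l<v , v<r ← Separated-split w
           (λ v∈w → proj₂ (proj₂ (All.lookup (F .within) v∈w)) (here refl))
           (All.head (F .separated))
    = l , r , refl , L , R
    where
    us = AllPairs-++⁻ l (F .unique)
    L : Filling x [] v l
    L = record
      { unique    = proj₁ us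
      ; within    = All.zipWith (λ ((p , _) , q) → p , q , λ ()) (All.++⁻ˡ l (F .within) , l<v)
      ; full      = λ {z} x<z z<v _ →
          [ (λ z∈l → z∈l) , (λ z∈r → contradiction (All.lookup v<r z∈r) (ℕ.<-asym z<v)) ]′
          (∈-++⁻ l (F .full x<z (ℕ.<-trans z<v v<y)
            λ { (here refl) → ℕ.<-irrefl refl z<v
              ; (there z∈s) → ℕ.<-asym z<v (All.lookup v<s z∈s) }))
      ; avoiding  = Avoiding-++⁻ˡ l (F .avoiding)
      ; separated = []
      }
    R : Filling v s y r
    R = record
      { unique    = proj₁ (proj₂ us)
      ; within    = All.zipWith (λ ((_ , q , z∉) , p) → p , q , z∉ ∘ there)
                                (All.++⁻ʳ l (F .within) , v<r)
      ; full      = λ {z} v<z z<y z∉s →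
          [ (λ z∈l → contradiction (All.lookup l<v z∈l) (ℕ.<-asym v<z)) , (λ z∈r → z∈r) ]′
          (∈-++⁻ l (F .full (ℕ.<-trans x<v v<z) z<y
            λ { (here refl) → ℕ.<-irrefl refl v<z
              ; (there z∈s) → z∉s z∈s }))
      ; avoiding  = proj₁ (Avoiding-++⁻ l (F .avoiding))
      ; separated = All.map (proj₁ ∘ proj₂ ∘ AllPairs-++⁻ l) (All.tail (F .separated))
      }

  -- All of `l` lies below `v` and all of `r` above it, so a pattern with its 2 in `l` cannot take
  -- its 1 from `r`.
  Filling-join : ∀ {l r} → Filling x [] v l → Filling v s y r → Filling x (v ∷ s) y (l ++ r)
  Filling-join {l} {r} L R = record
    { unique    = Unique.++⁺ (L .unique) (R .unique)
                    (λ (z∈l , z∈r) → ℕ.<-asym (All.lookup l<v z∈l) (All.lookup v<r z∈r))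
    ; within    = All.++⁺
        (All.map (λ (p , q , _) → p , ℕ.<-trans q v<y ,
           λ { (here refl) → ℕ.<-irrefl refl q
             ; (there z∈s) → ℕ.<-asym q (All.lookup v<s z∈s) }) (L .within))
        (All.map (λ (p , q , z∉s) → ℕ.<-trans x<v p , q ,
           λ { (here refl) → ℕ.<-irrefl refl p
             ; (there z∈s) → z∉s z∈s }) (R .within))
    ; full      = ∈-full
    ; avoiding  = Avoiding-++⁺ (L .avoiding) (R .avoiding)
        (All.map (λ a<v → AllPairs.map (λ v<b _ → ℕ.<-trans a<v v<b) v<tails) l<v)
        (All⇒AllPairs (λ a<v _ → All.map (ℕ.<-trans a<v) v<r) l<v)
    ; separated =
        AllPairs.++⁺ (All⇒AllPairs (λ a<v v<a → contradiction v<a (ℕ.<-asym a<v)) l<v)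
                     (AllPairs.map (λ v<b _ → v<b) v<tails)
                     (All.map (λ a<v → All.map (λ v<b _ → v<b) v<r) l<v)
        -- An entry `u` of `s` exceeds `v`, hence all of `l`; a pair whose first member is in `l`
        -- satisfies the condition vacuously.
        ∷ All.zipWith (λ (v<u , su) →
            AllPairs.++⁺ (All⇒AllPairs (below v<u) l<v) su
              (All.map (λ a<v → All.universal (λ _ → below v<u a<v) _) l<v))
          (v<s , R .separated)
    }
    where
    below : ∀ {a b u} → v ℕ.< u → a ℕ.< v → u ℕ.< a → u ℕ.< b
    below v<u a<v u<a = contradiction (ℕ.<-trans a<v v<u) (ℕ.<-asym u<a)
    l<v : All (ℕ._< v) l
    l<v = All.map (proj₁ ∘ proj₂) (L .within)
    v<r : All (v ℕ.<_) r
    v<r = All.map proj₁ (R .within)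
    v<tails : AllPairs (λ _ b → v ℕ.< b) r
    v<tails = go v<r
      where
      go : ∀ {r} → All (v ℕ.<_) r → AllPairs (λ _ b → v ℕ.< b) r
      go []       = []
      go (_ ∷ ps) = ps ∷ go ps
    ∈-full : ∀ {z} → x ℕ.< z → z ℕ.< y → z ∉ v ∷ s → z ∈ l ++ r
    ∈-full {z} x<z z<y z∉ with ℕ.<-cmp z v
    ... | tri< z<v _ _ = ∈-++⁺ˡ (L .full x<z z<v λ ())
    ... | tri≈ _ z≡v _ = contradiction (here z≡v) z∉
    ... | tri> _ _ v<z = ∈-++⁺ʳ l (R .full v<z z<y (z∉ ∘ there))

-- Counting by duplicate-free lists.

record Enumerates {A : Set} (xs : List A) (P : A → Set) (n : ℕ) : Set where
  field
    distinct : Unique xs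
    size     : length xs ≡ n
    sound    : ∀ {x} → x ∈ xs → P x
    complete : ∀ {x} → P x → x ∈ xs

open Enumerates

module _ {A : Set} where

  Enumerates-resp : ∀ {xs : List A} {P Q n} → (∀ {x} → P x → Q x) → (∀ {x} → Q x → P x) →
                    Enumerates xs P n → Enumerates xs Q n
  Enumerates-resp f g E = record
    { distinct = E .distinct
    ; size     = E .size
    ; sound    = f ∘ E .sound
    ; complete = E .complete ∘ g
    }

  Enumerates-⊎ : ∀ {xs ys : List A} {P Q m n} → (∀ {x} → P x → ¬ Q x) →
                 Enumerates xs P m → Enumerates ys Q n →
                 Enumerates (xs ++ ys) (λ x → P x ⊎ Q x) (m + n)
  Enumerates-⊎ {xs} disj E F = record
    { distinct = Unique.++⁺ (E .distinct) (F .distinct)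
                   (λ (x∈xs , x∈ys) → disj (E .sound x∈xs) (F .sound x∈ys))
    ; size     = trans (length-++ xs) (cong₂ _+_ (E .size) (F .size))
    ; sound    = λ x∈ → Sum.map (E .sound) (F .sound) (∈-++⁻ xs x∈)
    ; complete = [ ∈-++⁺ˡ ∘ E .complete , ∈-++⁺ʳ xs ∘ F .complete ]′
    }

_⊗_ : List (List ℕ) → List (List ℕ) → List (List ℕ)
_⊗_ = cartesianProductWith _++_

length-⊗ : ∀ ls rs → length (ls ⊗ rs) ≡ length ls * length rs
length-⊗ []       rs = refl
length-⊗ (l ∷ ls) rs =
  trans (length-++ (map (l ++_) rs)) (cong₂ _+_ (length-map (l ++_) rs) (length-⊗ ls rs))

-- Distinct pairs could concatenate to the same word; `P` fixes the cut and so recovers both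
-- factors.
Unique-⊗ : ∀ {P : ℕ → Set} {ls rs} → All (All P) ls → All (All (¬_ ∘ P)) rs →
           Unique ls → Unique rs → Unique (ls ⊗ rs)
Unique-⊗ {P} []                    prs []         urs = []
Unique-⊗ {P} {l ∷ ls} {rs} (pl ∷ pls) prs (l∉ls ∷ uls) urs =
  Unique.++⁺ (Unique.map⁺ (++-cancelˡ l _ _) urs) (Unique-⊗ pls prs uls urs) disjoint
  where
  disjoint : ∀ {w} → ¬ (w ∈ map (l ++_) rs × w ∈ ls ⊗ rs)
  disjoint (w∈ , w∈′)
    with r , r∈rs , refl ← ∈-map⁻ (l ++_) w∈
    with l′ , r′ , l′∈ls , r′∈rs , eq ← ∈-cartesianProductWith⁻ _++_ ls rs w∈′
    = All.lookup l∉ls l′∈ls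
        (proj₁ (++-injective-by pl (All.lookup pls l′∈ls)
                  (All.lookup prs r∈rs) (All.lookup prs r′∈rs) eq))

module _ {x v y : ℕ} {s : List ℕ} (x<v : x ℕ.< v) (v<y : v ℕ.< y) (v<s : All (v ℕ.<_) s) where

  Enumerates-⊗ : ∀ {ls rs m n} → Enumerates ls (Filling x [] v) m →
                 Enumerates rs (Filling v s y) n →
                 Enumerates (ls ⊗ rs) (Filling x (v ∷ s) y) (m * n)
  Enumerates-⊗ {ls} {rs} E F = record
    { distinct = Unique-⊗ {P = ℕ._< v}
        (All.tabulate λ l∈ → All.map (proj₁ ∘ proj₂) (E .sound l∈ .within))
        (All.tabulate λ r∈ → All.map (ℕ.<-asym ∘ proj₁) (F .sound r∈ .within))
        (E .distinct) (F .distinct)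
    ; size     = trans (length-⊗ ls rs) (cong₂ _*_ (E .size) (F .size))
    ; sound    = sound-⊗
    ; complete = complete-⊗
    }
    where
    sound-⊗ : ∀ {w} → w ∈ ls ⊗ rs → Filling x (v ∷ s) y w
    sound-⊗ w∈ with l , r , l∈ , r∈ , refl ← ∈-cartesianProductWith⁻ _++_ ls rs w∈
      = Filling-join x<v v<y v<s (E .sound l∈) (F .sound r∈)
    complete-⊗ : ∀ {w} → Filling x (v ∷ s) y w → w ∈ ls ⊗ rs
    complete-⊗ G with l , r , refl , L , R ← Filling-split x<v v<y v<s G
      = ∈-cartesianProductWith⁺ _++_ (E .complete L) (F .complete R)

-- Arrangements by first entry, and the Catalan recurrence.

data Rooted (x y : ℕ) (P : ℕ → Set) : List ℕ → Set where
  root : ∀ {v w} → P v → Filling x [] y (v ∷ w) → Rooted x y P (v ∷ w)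

-- A one-letter prefix has no ascent, so `NoCross` is vacuous and prepending `v` is a bijection.
rooted-enumeration : ∀ {x y v ws n} → x ℕ.< v → v ℕ.< y → Enumerates ws (Filling x [ v ] y) n →
                     Enumerates (map (v ∷_) ws) (Rooted x y (_≡ v)) n
rooted-enumeration {x} {y} {v} {ws} x<v v<y E = record
  { distinct = Unique.map⁺ ∷-injectiveʳ (E .distinct)
  ; size     = trans (length-map (v ∷_) ws) (E .size)
  ; sound    = sound-∷
  ; complete = λ { (root refl F) → ∈-map⁺ (v ∷_) (E .complete (Filling-++⁻ [ v ] F)) }
  }
  where
  sound-∷ : ∀ {w} → w ∈ map (v ∷_) ws → Rooted x y (_≡ v) w
  sound-∷ w∈ with w , w∈ws , refl ← ∈-map⁻ (v ∷_) w∈ =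
    root refl (Filling-++⁺ [ v ] ([] ∷ []) ((x<v , v<y) ∷ []) ([] ∷ []) ([] ∷ []) (E .sound w∈ws))

module _ (arrange : ℕ → ℕ → List (List ℕ)) where

  -- i and j count the entries below and above the first one.
  rootedAt : ℕ → ℕ → ℕ → List (List ℕ)
  rootedAt x i j = map (suc (x + i) ∷_) (arrange x i ⊗ arrange (suc (x + i)) j)

  rootedFrom : ℕ → ℕ → ℕ → List (List ℕ)
  rootedFrom x i zero    = rootedAt x i zero
  rootedFrom x i (suc j) = rootedAt x i (suc j) ++ rootedFrom x (suc i) j

-- The 231-avoiding arrangements of x + 1, …, x + m; the first argument is
-- fuel and must be at least m.
arrangements : ℕ → ℕ → ℕ → List (List ℕ)
arrangements _       x zero    = [ [] ]
arrangements zero    x (suc m) = []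
arrangements (suc f) x (suc m) = rootedFrom (arrangements f) x 0 m

module _ {arrange : ℕ → ℕ → List (List ℕ)} {f : ℕ}
  (ih : ∀ x {m} → m ℕ.≤ f → Enumerates (arrange x m) (Filling x [] (suc (x + m))) (ballot 1 m))
  where

  rootedAt-enumeration : ∀ x i j → i + j ℕ.≤ f →
    Enumerates (rootedAt arrange x i j) (Rooted x (2 + (x + i + j)) (_≡ suc (x + i)))
               (ballot 1 i * ballot 1 j)
  rootedAt-enumeration x i j i+j≤f =
    rooted-enumeration x<v v<y
      (Enumerates-⊗ x<v v<y []
        (ih x (ℕ.m+n≤o⇒m≤o i i+j≤f))
        (ih (suc (x + i)) (ℕ.m+n≤o⇒n≤o i i+j≤f)))
    where
    x<v : x ℕ.< suc (x + i)
    x<v = s≤s (ℕ.m≤m+n x i)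
    v<y : suc (x + i) ℕ.< 2 + (x + i + j)
    v<y = s≤s (s≤s (ℕ.m≤m+n (x + i) j))

  -- The least admissible first entry is split off and the rest recurses. The sum `i + j`, and with
  -- it the upper end, stays fixed; `y` is tied to it by an equation because the sums agree only
  -- propositionally.
  rootedFrom-enumeration : ∀ x i j {y} → 2 + (x + i + j) ≡ y → i + j ℕ.≤ f →
    Enumerates (rootedFrom arrange x i j) (Rooted x y (suc (x + i) ℕ.≤_))
               (convolve (ballot 1) (ballot 1) i j)
  rootedFrom-enumeration x i zero refl i+j≤f =
    Enumerates-resp (λ { (root refl F) → root ℕ.≤-refl F })
                    -- With no entries above, the upper end of the interval leaves a single possible
                    -- first entry.
                    (λ { (root {v} v≤ F) → root (ℕ.≤-antisym
                           (subst (v ℕ.≤_) (cong suc (ℕ.+-identityʳ (x + i)))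
                             (ℕ.s≤s⁻¹ (proj₁ (proj₂ (All.head (F .within)))))) v≤) F })
                    (rootedAt-enumeration x i zero i+j≤f)
  rootedFrom-enumeration x i (suc j) refl i+j≤f =
    Enumerates-resp
      (λ { (inj₁ (root refl F)) → root ℕ.≤-refl F
         ; (inj₂ (root {v} v≤ F)) →
             root (ℕ.≤-trans (ℕ.n≤1+n _) (subst (ℕ._≤ v) (cong suc (ℕ.+-suc x i)) v≤)) F })
      split
      (Enumerates-⊎
        (λ { (root {v} refl _) (root v< _) →
          ℕ.<-irrefl refl (subst (ℕ._≤ v) (cong suc (ℕ.+-suc x i)) v<) })
        (rootedAt-enumeration x i (suc j) i+j≤f)
        (rootedFrom-enumeration x (suc i) j
          (cong (2 +_) (trans (cong (_+ j) (ℕ.+-suc x i)) (sym (ℕ.+-suc (x + i) j))))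
          (subst (ℕ._≤ f) (ℕ.+-suc i j) i+j≤f)))
    where
    y : ℕ
    y = 2 + (x + i + suc j)
    split : ∀ {w} → Rooted x y (suc (x + i) ℕ.≤_) w →
            Rooted x y (_≡ suc (x + i)) w ⊎ Rooted x y (suc (x + suc i) ℕ.≤_) w
    split (root {v} v≤ F) with ℕ.m≤n⇒m<n∨m≡n v≤
    ... | inj₁ v< = inj₂ (root (subst (ℕ._≤ v) (cong suc (sym (ℕ.+-suc x i))) v<) F)
    ... | inj₂ v≡ = inj₁ (root (sym v≡) F)

-- Induction on the fuel: of `suc m` entries, those below and above the first number `m` together,
-- so one unit less suffices for both sides.
arrangements-enumeration : ∀ f x {m} → m ℕ.≤ f →
  Enumerates (arrangements f x m) (Filling x [] (suc (x + m))) (ballot 1 m)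
arrangements-enumeration f x {zero} _ = record
  { distinct = [] ∷ []
  ; size     = refl
  ; sound    = λ { (here refl) → record
      { unique = [] ; within = [] ; full = λ p q _ → contradiction q (empty p)
      ; avoiding = [] ; separated = [] } }
  ; complete = λ { {[]} _ → here refl
                 ; {z ∷ w} F → let p , q , _ = All.head (F .within) in contradiction q (empty p) }
  }
  where
  empty : ∀ {z} → x ℕ.< z → ¬ z ℕ.< suc (x + 0)
  empty x<z z< = ℕ.<⇒≱ x<z (subst (_ ℕ.≤_) (ℕ.+-identityʳ x) (ℕ.s≤s⁻¹ z<))
arrangements-enumeration (suc f) x {suc m} (s≤s m≤f) =
  -- The convolution gives `ballot 2 m`, which is `ballot 1 (suc m)` by computation since
  -- `ballot 0 (suc m)` is zero.
  subst (Enumerates _ _) (ballot-convolve 1 1 m)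
    (Enumerates-resp (λ { (root _ F) → F }) rooted
      (rootedFrom-enumeration (arrangements-enumeration f) x 0 m
        (cong suc (trans (cong (λ z → suc (z + m)) (ℕ.+-identityʳ x)) (sym (ℕ.+-suc x m)))) m≤f))
  where
  rooted : ∀ {w} → Filling x [] (suc (x + suc m)) w →
           Rooted x (suc (x + suc m)) (suc (x + 0) ℕ.≤_) w
  -- The value `suc x` lies in the interval, so the empty word is not `full`.
  rooted {[]}    F with () ← F .full (ℕ.n<1+n x) (s≤s (ℕ.m<m+n x ℕ.z<s)) (λ ())
  rooted {v ∷ w} F =
    root (subst (λ u → suc u ℕ.≤ v) (sym (ℕ.+-identityʳ x)) (proj₁ (All.head (F .within)))) F

-- The product over the gaps of a sorted prefix.

gapArrangements : ℕ → ℕ → List (List ℕ)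
gapArrangements x y = arrangements (y ∸ x ∸ 1) x (y ∸ x ∸ 1)

gapArrangements-enumeration : ∀ {x y} → x ℕ.< y →
  Enumerates (gapArrangements x y) (Filling x [] y) (catalan (y ∸ x ∸ 1))
gapArrangements-enumeration {x} {y} x<y =
  subst₂ (λ y′ → Enumerates (gapArrangements x y) (Filling x [] y′))
    y≡ (sym (catalan≡ballot (y ∸ x ∸ 1)))
    (arrangements-enumeration (y ∸ x ∸ 1) x ℕ.≤-refl)
  where
  open ≡-Reasoning
  y≡ : suc (x + (y ∸ x ∸ 1)) ≡ y
  y≡ = begin
    suc (x + (y ∸ x ∸ 1))    ≡⟨ cong (λ z → suc (x + z)) (ℕ.∸-+-assoc y x 1) ⟩
    suc (x + (y ∸ (x + 1)))  ≡⟨ cong (λ z → suc (x + (y ∸ z))) (ℕ.+-comm x 1) ⟩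
    suc x + (y ∸ suc x)      ≡⟨ ℕ.m+[n∸m]≡n x<y ⟩
    y                        ∎

fillings : ℕ → List ℕ → ℕ → List (List ℕ)
fillings x []      y = gapArrangements x y
fillings x (v ∷ s) y = gapArrangements x v ⊗ fillings v s y

-- Removing the least entry `v` matches the zip: its head is the factor of the gap from `x` to `v`,
-- and its tail is the same product with lower end `v`.
fillings-enumeration : ∀ {x y} s → x ℕ.< y → AllPairs ℕ._<_ (x ∷ s) → All (ℕ._< y) s →
  Enumerates (fillings x s y) (Filling x s y)
    (product (zipWith (λ x y → catalan (y ∸ x ∸ 1)) (x ∷ s) (s ++ [ y ])))
fillings-enumeration [] x<y _ _ =
  subst (Enumerates _ _) (sym (ℕ.*-identityʳ _)) (gapArrangements-enumeration x<y)
fillings-enumeration (v ∷ s) x<y ((x<v ∷ _) ∷ ord@(v<s ∷ _)) (v<y ∷ s<y) =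
  Enumerates-⊗ x<v v<y v<s (gapArrangements-enumeration x<v)
    (fillings-enumeration s v<y ord s<y)

-- Permutations as words.

private
  variable
    m n t : ℕ

tabulate-injective : ∀ {A : Set} {f g : Fin n → A} → tabulate f ≡ tabulate g → ∀ i → f i ≡ g i
tabulate-injective eq zero    = ∷-injectiveˡ eq
tabulate-injective eq (suc i) = tabulate-injective (∷-injectiveʳ eq) i

AllPairs-tabulate⁻ : ∀ {A : Set} {R : A → A → Set} {f : Fin n → A} →
                     AllPairs R (tabulate f) → ∀ {i j} → i < j → R (f i) (f j)
AllPairs-tabulate⁻ (r ∷ _)  {zero}  {suc j} _         = All.tabulate⁻ r j
AllPairs-tabulate⁻ (_ ∷ rs) {suc i} {suc j} (s<s i<j) = AllPairs-tabulate⁻ rs i<j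

Unique-lookup-injective : ∀ {A : Set} {xs : List A} → Unique xs →
                          ∀ {i j} → lookup xs i ≡ lookup xs j → i ≡ j
Unique-lookup-injective (_ ∷ _)   {zero}  {zero}  _  = refl
Unique-lookup-injective (x∉ ∷ _)  {zero}  {suc j} eq = contradiction eq (All.lookup x∉ (∈-lookup j))
Unique-lookup-injective (x∉ ∷ _)  {suc i} {zero}  eq = contradiction (sym eq) (All.lookup x∉ (∈-lookup i))
Unique-lookup-injective (_ ∷ xs!) {suc i} {suc j} eq = cong suc (Unique-lookup-injective xs! eq)

module _ (A : Setoid 0ℓ 0ℓ) {X : Set} where
  open Setoid A using (Carrier; _≈_)

  -- An element is sent to the position of its code in the list. Codes are compared only up to
  -- `_≈_`, so proofs of membership in the carrier do not affect the count.
  enumeration⇒cardinality : ∀ {xs : List X} {P k} → Enumerates xs P k →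
    (code : Carrier → X) → (∀ {a b} → a ≈ b → code a ≡ code b) →
    (∀ {a b} → code a ≡ code b → a ≈ b) →
    (∀ a → P (code a)) → (∀ {x} → P x → ∃[ a ] code a ≡ x) → HasCardinality A k
  enumeration⇒cardinality {xs} E@record { distinct = xs! ; size = refl }
    code code-cong code-injective code-P decode = record
    { to        = to
    ; from      = λ i → proj₁ (decode (E .sound (∈-lookup i)))
    ; to-cong   = λ {a} {b} a≈b → Unique-lookup-injective xs!
        (trans (lookup-to a) (trans (code-cong a≈b) (sym (lookup-to b))))
    ; from-cong = λ { refl → Setoid.refl A }
    ; inverse   =
        (λ {i} {a} a≈ → Unique-lookup-injective xs!
          (trans (lookup-to a) (trans (code-cong a≈) (proj₂ (decode (E .sound (∈-lookup i)))))))
      , (λ { {a} refl → code-injective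
          (trans (proj₂ (decode (E .sound (∈-lookup (to a))))) (lookup-to a)) })
    }
    where
    to : Carrier → Fin (length xs)
    to a = Any.index (E .complete (code-P a))
    lookup-to : ∀ a → lookup xs (to a) ≡ code a
    lookup-to a = sym (lookup-index (E .complete (code-P a)))

label-injective : ∀ {i j : Fin n} → label i ≡ label j → i ≡ j
label-injective = Fin.toℕ-injective ∘ ℕ.suc-injective

word : (Fin m → Fin n) → List ℕ
word f = tabulate (label ∘ f)

-- Otherwise injectivity would put `f k` strictly below `f i`, and `i`, `j`, `k` would carry a 231.
avoids⇒< : {f : Fin m → Fin n} → Injective _≡_ _≡_ f → Avoids f pattern231 →
           ∀ {i j k} → i < j → j < k → f i < f j → f i < f k
avoids⇒< {f = f} inj av {i} {j} {k} i<j j<k fi<fj with f i Fin.<? f k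
... | yes fi<fk = fi<fk
... | no  fi≮fk = contradiction (ι , (λ {a} {b} → ι-mono {a} {b}) , λ {a} {b} → ι-order {a} {b}) av
  where
  fk<fi : f k < f i
  fk<fi = ℕ.≤∧≢⇒< (ℕ.≮⇒≥ fi≮fk)
    (λ eq → ℕ.<-irrefl (cong toℕ (inj (Fin.toℕ-injective (sym eq)))) (ℕ.<-trans i<j j<k))
  ι : Fin 3 → Fin _
  ι 0F = i
  ι 1F = j
  ι 2F = k
  ι-mono : ∀ {a b} → a < b → ι a < ι b
  ι-mono {0F} {1F} _ = i<j
  ι-mono {0F} {2F} _ = ℕ.<-trans i<j j<k
  ι-mono {1F} {2F} _ = j<k
  ι-mono {1F} {1F} (s<s ())
  ι-mono {2F} {1F} (s<s ())
  ι-mono {2F} {2F} (s<s (s<s ()))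
  ι-order : ∀ {a b} → a < b → (f (ι a) < f (ι b)) ⇔ (pattern231 ⟨$⟩ʳ a < pattern231 ⟨$⟩ʳ b)
  ι-order {0F} {1F} _ = mk⇔ (λ _ → s<s z<s) (λ _ → fi<fj)
  ι-order {0F} {2F} _ = mk⇔ (λ p → contradiction p fi≮fk) (λ ())
  ι-order {1F} {2F} _ = mk⇔ (λ p → contradiction (ℕ.<-trans fk<fi fi<fj) (ℕ.<-asym p)) (λ ())
  ι-order {1F} {1F} (s<s ())
  ι-order {2F} {1F} (s<s ())
  ι-order {2F} {2F} (s<s (s<s ()))

avoids⇒Avoiding : {f : Fin m → Fin n} → Injective _≡_ _≡_ f → Avoids f pattern231 →
                  Avoiding (word f)
avoids⇒Avoiding inj av = go (avoids⇒< inj av)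
  where
  go : ∀ {m} {f : Fin m → Fin _} →
       (∀ {i j k} → i < j → j < k → f i < f j → f i < f k) → Avoiding (word f)
  go {zero}  _ = []
  go {suc m} h = AllPairs.tabulate⁺-< (λ i<j p → s<s (h z<s (s<s i<j) (ℕ.s<s⁻¹ p)))
                 ∷ go (λ i<j j<k → h (s<s i<j) (s<s j<k))

Avoiding⇒avoids : {f : Fin m → Fin n} → Avoiding (word f) → Avoids f pattern231
Avoiding⇒avoids {f = f} av (ι , mono , order) =
  -- In a copy of 231 the 2 is below the 3, so `go` puts it below the 1 as well; `order` turns this
  -- into `1F < 0F`.
  contradiction (Equivalence.to (order {0F} {2F} z<s)
    (go av (mono {0F} {1F} z<s) (mono {1F} {2F} (s<s z<s))
      (Equivalence.from (order {0F} {1F} z<s) (s<s z<s)))) λ ()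
  where
  go : ∀ {m} {f : Fin m → Fin _} → Avoiding (word f) →
       ∀ {i j k} → i < j → j < k → f i < f j → f i < f k
  go (s ∷ _)  {zero}  {suc j} {suc k} _ (s<s j<k) p = ℕ.s<s⁻¹ (AllPairs-tabulate⁻ s j<k (s<s p))
  go (_ ∷ av) {suc i} {suc j} {suc k} (s<s i<j) (s<s j<k) p = go av i<j j<k p

word-prefix⁺ : .(t≤n : t ℕ.≤ m) {f : Fin m → Fin n} {c : Fin t → Fin n} →
               (∀ i → f (inject≤ i t≤n) ≡ c i) → word f ≡ word c ++ drop t (word f)
word-prefix⁺ {t = zero}              _   _  = refl
word-prefix⁺ {t = suc t} {m = suc m} t≤n eq =
  cong₂ _∷_ (cong label (eq zero)) (word-prefix⁺ (ℕ.s≤s⁻¹ t≤n) (eq ∘ suc))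

word-prefix⁻ : .(t≤n : t ℕ.≤ m) {f : Fin m → Fin n} {c : Fin t → Fin n} {w : List ℕ} →
               word f ≡ word c ++ w → ∀ i → f (inject≤ i t≤n) ≡ c i
word-prefix⁻ {m = suc m} t≤n eq zero    = label-injective (∷-injectiveˡ eq)
word-prefix⁻ {m = suc m} t≤n eq (suc i) = word-prefix⁻ (ℕ.s≤s⁻¹ t≤n) (∷-injectiveʳ eq) i

drop-word : (c : Fin t → Fin n) (w : List ℕ) → drop t (word c ++ w) ≡ w
drop-word {t = zero}  c w = refl
drop-word {t = suc t} c w = drop-word (c ∘ suc) w

word-surjective : ∀ {w} → length w ≡ m → All (λ z → 0 ℕ.< z × z ℕ.< suc n × z ∉ []) w →
                  Σ[ f ∈ (Fin m → Fin n) ] word f ≡ w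
word-surjective {w = []}         refl []                       = (λ ()) , refl
word-surjective {n = n} {w = suc z ∷ w} refl ((_ , s≤s z<n , _) ∷ ps) =
  let f , eq = word-surjective refl ps
  in (λ { zero → fromℕ< z<n ; (suc i) → f i }) , cong₂ _∷_ (cong suc (Fin.toℕ-fromℕ< z<n)) eq

permutation-filling : (τ : Permutation′ n) → Avoids (τ ⟨$⟩ʳ_) pattern231 →
                      Filling 0 [] (suc n) (word (τ ⟨$⟩ʳ_))
permutation-filling {n} τ av = record
  { unique    = Unique.tabulate⁺ (τ-injective ∘ label-injective)
  ; within    = All.tabulate⁺ λ i → z<s , s<s (Fin.toℕ<n (τ ⟨$⟩ʳ i)) , λ ()
  ; full      = λ { {suc z} _ (s<s z<n) _ →
      subst (_∈ word (τ ⟨$⟩ʳ_))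
        (trans (cong label (inverseʳ τ)) (cong suc (Fin.toℕ-fromℕ< z<n)))
        (∈-tabulate⁺ (τ ⟨$⟩ˡ fromℕ< z<n)) }
  ; avoiding  = avoids⇒Avoiding τ-injective av
  ; separated = []
  }
  where
  τ-injective : Injective _≡_ _≡_ (τ ⟨$⟩ʳ_)
  τ-injective {i} {j} eq =
    trans (sym (Inverse.strictlyInverseʳ τ i))
      (trans (cong (τ ⟨$⟩ˡ_) eq) (Inverse.strictlyInverseʳ τ j))

filling-permutation : ∀ {w} → Filling 0 [] (suc n) w →
                      Σ[ τ ∈ Permutation′ n ] word (τ ⟨$⟩ʳ_) ≡ w
filling-permutation {n} {w} F = permutation f (proj₁ ∘ surj) (sym ∘ proj₂ ∘ surj)
                           (λ i → f-injective (sym (proj₂ (surj (f i))))) , f≡w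
  where
  -- Both `w` and the list of all labels are duplicate-free with the same members, hence
  -- rearrangements of each other.
  length≡ : length w ≡ n
  length≡ = trans
    (↭-length (∼bag⇒↭ (unique∧set⇒bag (F .unique) (Unique.tabulate⁺ label-injective)
      (mk⇔ (λ z∈w → in-range (All.lookup (F .within) z∈w)) from-range))))
    (length-tabulate label)
    where
    in-range : ∀ {z} → 0 ℕ.< z × z ℕ.< suc n × z ∉ [] → z ∈ tabulate (label {n})
    in-range {suc z} (_ , s<s z<n , _) =
      subst (_∈ tabulate (label {n})) (cong suc (Fin.toℕ-fromℕ< z<n)) (∈-tabulate⁺ (fromℕ< z<n))
    from-range : ∀ {z} → z ∈ tabulate (label {n}) → z ∈ w
    from-range z∈ with i , refl ← ∈-tabulate⁻ z∈ = F .full z<s (s<s (Fin.toℕ<n i)) λ ()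
  decoded : Σ[ f ∈ (Fin n → Fin n) ] word f ≡ w
  decoded = word-surjective length≡ (F .within)
  f : Fin n → Fin n
  f = proj₁ decoded
  f≡w : word f ≡ w
  f≡w = proj₂ decoded
  surj : ∀ y → ∃[ i ] y ≡ f i
  surj y =
    let i , eq = ∈-tabulate⁻ (subst (label y ∈_) (sym f≡w) (F .full z<s (s<s (Fin.toℕ<n y)) λ ()))
    in i , label-injective eq
  w! : Unique (word f)
  w! = subst Unique (sym f≡w) (F .unique)
  f-injective : Injective _≡_ _≡_ f
  f-injective {i} {j} eq with Fin.<-cmp i j
  ... | tri< i<j _ _ = contradiction (cong label eq) (AllPairs-tabulate⁻ w! i<j)
  ... | tri≈ _ i≡j _ = i≡j
  ... | tri> _ _ j<i = contradiction (cong label (sym eq)) (AllPairs-tabulate⁻ w! j<i)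

-- Blocked and unblocked prefixes.

Blocked : (Fin t → Fin n) → Set
Blocked c = ∃[ i ] ∃[ j ] i < j × c i < c j × (∃[ α ] α < c i × (∀ l → α ≢ c l))

module _ (t≤n : t ℕ.≤ n) (c : Fin t → Fin n) where

  S231 : Setoid 0ℓ 0ℓ
  S231 = S t≤n c [ (3 , pattern231) ]

  open Setoid S231 using (Carrier; _≈_)

  suffix : Carrier → List ℕ
  suffix (τ , _) = drop t (word (τ ⟨$⟩ʳ_))

  word-suffix : (a : Carrier) → word (proj₁ a ⟨$⟩ʳ_) ≡ word c ++ suffix a
  word-suffix (_ , τ-prefix , _) = word-prefix⁺ t≤n τ-prefix

  suffix-cong : ∀ {a b} → a ≈ b → suffix a ≡ suffix b
  suffix-cong a≈b = cong (drop t) (tabulate-cong (cong label ∘ a≈b))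

  suffix-extends : (a : Carrier) → Filling 0 [] (suc n) (word c ++ suffix a)
  suffix-extends a@(τ , _ , av ∷ []) =
    subst (Filling 0 [] (suc n)) (word-suffix a) (permutation-filling τ av)

  -- The missing value `α` must occur after the prefix, where it completes `c i`, `c j` to a 231.
  blocked-cardinality : Blocked c → HasCardinality S231 0
  blocked-cardinality (i , j , i<j , ci<cj , α , α<ci , α∉c) =
    enumeration⇒cardinality S231 {P = λ _ → ⊥}
      record { distinct = [] ; size = refl ; sound = λ () ; complete = λ () }
      suffix (λ {a} {b} → suffix-cong {a} {b})
      (λ {a} _ → ⊥-elim (empty a)) empty λ ()
    where
    empty : ¬ Carrier
    empty a = ℕ.<-asym (s<s α<ci)
      (All.lookup (AllPairs-tabulate⁻ noCross i<j (s<s ci<cj)) α∈suffix)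
      where
      F : Filling 0 [] (suc n) (word c ++ suffix a)
      F = suffix-extends a
      noCross : NoCross (word c) (suffix a)
      noCross = proj₂ (proj₂ (Avoiding-++⁻ (word c) (F .avoiding)))
      α∈suffix : label α ∈ suffix a
      α∈suffix = Filling-++⁻ (word c) F .full z<s (s<s (Fin.toℕ<n α))
        (λ α∈c → let l , eq = ∈-tabulate⁻ α∈c in α∉c l (label-injective eq))

  -- An entry of `w` below `c i` would be missing from the prefix and serve as a blocking `α`;
  -- equality with `c i` is impossible since `w` shares no entry with `c`.
  unblocked⇒NoCross : ¬ Blocked c → ∀ {w} → Filling 0 (word c) (suc n) w → NoCross (word c) w
  unblocked⇒NoCross ¬blocked F = AllPairs.tabulate⁺-< λ i<j p → All.map (above i<j p) (F .within)
    where
    above : ∀ {i j z} → i < j → label (c i) ℕ.< label (c j) →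
            0 ℕ.< z × z ℕ.< suc n × z ∉ word c → label (c i) ℕ.< z
    above {i} {j} {suc z} i<j (s<s ci<cj) (_ , s<s z<n , z∉c) with ℕ.<-cmp (label (c i)) (suc z)
    ... | tri< ci<z _ _ = ci<z
    ... | tri≈ _ refl _ = contradiction (∈-tabulate⁺ i) z∉c
    ... | tri> _ _ (s<s z<ci) = contradiction
      (i , j , i<j , ci<cj , fromℕ< z<n , subst (ℕ._< toℕ (c i)) (sym (Fin.toℕ-fromℕ< z<n)) z<ci ,
        λ l eq → z∉c (subst (_∈ word c)
          (cong suc (trans (cong toℕ (sym eq)) (Fin.toℕ-fromℕ< z<n))) (∈-tabulate⁺ l)))
      ¬blocked

  -- Suffixes of members correspond to fillings for `word c`, and sorting the prefix turns these
  -- into the ones already counted. The avoidance of `c` and `NoCross` enter in `decode`, where a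
  -- filling is completed to a permutation.
  unblocked-cardinality : Injective _≡_ _≡_ c → Avoids c pattern231 → ¬ Blocked c →
                          HasCardinality S231 (catalanProduct c)
  unblocked-cardinality c-injective c-avoids ¬blocked =
    enumeration⇒cardinality S231 (fillings-enumeration s z<s (s>0 ∷ s-increasing) s≤n)
      suffix (λ {a} {b} → suffix-cong {a} {b}) (λ {a} {b} → suffix-injective {a} {b})
      (λ a → Filling-resp-↭ (↭-sym (sort-↭ (word c))) (Filling-++⁻ (word c) (suffix-extends a)))
      (decode ∘ Filling-resp-↭ (sort-↭ (word c)))
    where
    s : List ℕ
    s = sort (word c)
    c! : Unique (word c)
    c! = Unique.tabulate⁺ (c-injective ∘ label-injective)
    s>0 : All (0 ℕ.<_) s
    s>0 = All-resp-↭ (↭-sym (sort-↭ (word c))) (All.tabulate⁺ λ _ → z<s)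
    s≤n : All (ℕ._< suc n) s
    s≤n = All-resp-↭ (↭-sym (sort-↭ (word c))) (All.tabulate⁺ λ i → s<s (Fin.toℕ<n (c i)))
    s-increasing : AllPairs ℕ._<_ s
    s-increasing = AllPairs.zipWith (λ (x≤y , x≢y) → ℕ.≤∧≢⇒< x≤y x≢y)
      ( Sorted⇒AllPairs ℕ.≤-totalOrder (sort-↗ (word c))
      , PermutationSetoid.Unique-resp-↭ (setoid ℕ) (↭⇒↭ₛ (↭-sym (sort-↭ (word c)))) c!)
    suffix-injective : ∀ {a b} → suffix a ≡ suffix b → a ≈ b
    suffix-injective {a} {b} eq = label-injective ∘ tabulate-injective
      (trans (word-suffix a) (trans (cong (word c ++_) eq) (sym (word-suffix b))))
    decode : ∀ {w} → Filling 0 (word c) (suc n) w → ∃[ a ] suffix a ≡ w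
    decode {w} F =
      let cw       = Filling-++⁺ (word c) c! (All.tabulate⁺ λ i → z<s , s<s (Fin.toℕ<n (c i)))
                       (avoids⇒Avoiding c-injective c-avoids) (unblocked⇒NoCross ¬blocked F) F
          τ , eq   = filling-permutation cw
          τ-avoids = Avoiding⇒avoids (subst Avoiding (sym eq) (cw .avoiding))
      in (τ , word-prefix⁻ t≤n eq , τ-avoids ∷ []) , trans (cong (drop t) eq) (drop-word c w)

theorem4p1 : (n t : ℕ) → 3 ℕ.≤ n → 1 ℕ.≤ t → (t<n : t ℕ.< n) →
    (c : Fin t → Fin n) → Injective _≡_ _≡_ c → Avoids c pattern231 →
    let Blocked = ∃[ i ] ∃[ j ] i < j × c i < c j × (∃[ α ] α < c i × (∀ l → α ≢ c l))
        S231    = S (<⇒≤ t<n) c [ (3 , pattern231) ]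
    in (Blocked → HasCardinality S231 0) ×
       (¬ Blocked → HasCardinality S231 (catalanProduct c))
theorem4p1 n t _ _ t<n c c-injective c-avoids =
  blocked-cardinality t≤n c , unblocked-cardinality t≤n c c-injective c-avoids
  where
  t≤n : t ℕ.≤ n
  t≤n = <⇒≤ t<n
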